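{- The structure $\mathsf{TLH}$ is a lower semilattice. For every pair of equivalence relations $E^{\mathrm{ce}}$ and $F^{\mathrm{ce}}$ on $\omega$ extending $=^{\mathrm{ce}}$, the meet (greatest lower bound) of $[E^{\mathrm{ce}}]_{\equiv_{\mathrm{Learn}}}$ and $[F^{\mathrm{ce}}]_{\equiv_{\mathrm{Learn}}}$ is $[E^{\mathrm{ce}}\cap F^{\mathrm{ce}}]_{\equiv_{\mathrm{Learn}}}$.
   Context: Fix a standard (acceptable) enumeration $(\varphi_e)_{e\in\omega}$ of the partial computable functions and let $W_e=\operatorname{dom}(\varphi_e)$. Write $e=^{\mathrm{ce}}e'$ iff $W_e=W_{e'}$. Let $\mathcal{R}^{\mathrm{ce}}$ be the set of all equivalence relations on $\omega$ extending $=^{\mathrm{ce}}$ (no definability or effectivity is assumed). An enumeration of a set $A$ is a surjection $\mu:\omega\to A$; $\mu[s]$ denotes the finite string $\mu(0),\dots,\mu(s-1)$. A learner is an arbitrary function $\mathbf{M}:\omega^{<\omega}\to\omega$ (no effectivity is assumed). For $E^{\mathrm{ce}}\in\mathcal{R}^{\mathrm{ce}}$, a family $\mathfrak{K}$ of nonempty c.e. sets is $E^{\mathrm{ce}}$-learnable if there is a learner $\mathbf{M}$ such that for every $e$ with $W_e\in\mathfrak{K}$ and every enumeration $\mu$ of $W_e$ there is $i\in\omega$ with $i\mathrel{E^{\mathrm{ce}}}e$ and $\mathbf{M}(\mu[s])=i$ for all sufficiently large $s$. $E^{\mathrm{ce}}\leq_{\mathrm{Learn}}F^{\mathrm{ce}}$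 means that every $E^{\mathrm{ce}}$-learnable family of nonempty c.e. sets is also $F^{\mathrm{ce}}$-learnable; $E^{\mathrm{ce}}\equiv_{\mathrm{Learn}}F^{\mathrm{ce}}$ means both $E^{\mathrm{ce}}\leq_{\mathrm{Learn}}F^{\mathrm{ce}}$ and $F^{\mathrm{ce}}\leq_{\mathrm{Learn}}E^{\mathrm{ce}}$. The tolerant learning hierarchy $\mathsf{TLH}$ is the poset $(\mathcal{E}^{\mathrm{ce}},\leq)$ where $\mathcal{E}^{\mathrm{ce}}=\mathcal{R}^{\mathrm{ce}}/{\equiv_{\mathrm{Learn}}}$ and $\leq$ is induced by $\leq_{\mathrm{Learn}}$. A lower semilattice is a poset in which any two elements have a greatest lower bound. -}

module Defs where

open import Data.Fin.Base using (Fin)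
open import Data.List.Base using (List; applyUpTo)
open import Data.Nat.Base using (ℕ; zero; suc; _<_; _≥_)
open import Data.Product.Base using (Σ; ∃; ∃-syntax; _×_; _,_; proj₁; proj₂; swap)
open import Data.Vec.Base using (Vec; []; _∷_; lookup)
open import Function.Base using (id; _∘_)
open import Function.Bundles using (_⇔_)
open import Level using (Level; _⊔_; 0ℓ) renaming (suc to lsuc)
open import Relation.Binary.Bundles using (Poset)
open import Relation.Binary.Core using (Rel; REL; _⇒_)
open import Relation.Binary.Definitions using (_Respects_)
open import Relation.Binary.PropositionalEquality.Core using (_≡_)
open import Relation.Binary.Structures using (IsEquivalence)
import Relation.Binary.Construct.Intersection as Intersection
open import Relation.Unary using (Pred; _∈_; _≐_; Satisfiable)

------------------------------------------------------------------------
-- Partial computable functions, as μ-recursive functions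

data Rec : ℕ → Set where
  zeroᶠ : Rec 0
  sucᶠ  : Rec 1
  proj  : ∀ {n} → Fin n → Rec n
  comp  : ∀ {m n} → Rec m → Vec (Rec n) m → Rec n
  prec  : ∀ {n} → Rec n → Rec (suc (suc n)) → Rec (suc n)
  minim : ∀ {n} → Rec (suc n) → Rec n

-- f ⟨ xs ⟩↓ y : the computation of f on xs halts with output y.

infix 4 _⟨_⟩↓_ _⟨_⟩↓*_

mutual
  data _⟨_⟩↓_ : ∀ {n} → Rec n → Vec ℕ n → ℕ → Set where
    zero↓ : zeroᶠ ⟨ [] ⟩↓ 0
    suc↓  : ∀ {x} → sucᶠ ⟨ x ∷ [] ⟩↓ suc x
    proj↓ : ∀ {n} {i : Fin n} {xs} → proj i ⟨ xs ⟩↓ lookup xs i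
    comp↓ : ∀ {m n} {f : Rec m} {gs : Vec (Rec n) m} {xs ys z} →
            gs ⟨ xs ⟩↓* ys → f ⟨ ys ⟩↓ z → comp f gs ⟨ xs ⟩↓ z
    precᶻ : ∀ {n} {f : Rec n} {g xs z} →
            f ⟨ xs ⟩↓ z → prec f g ⟨ zero ∷ xs ⟩↓ z
    precˢ : ∀ {n} {f : Rec n} {g k xs y z} →
            prec f g ⟨ k ∷ xs ⟩↓ y → g ⟨ k ∷ y ∷ xs ⟩↓ z →
            prec f g ⟨ suc k ∷ xs ⟩↓ z
    min↓  : ∀ {n} {f : Rec (suc n)} {xs y} →
            f ⟨ y ∷ xs ⟩↓ 0 →
            (∀ k → k < y → ∃[ v ] f ⟨ k ∷ xs ⟩↓ suc v) →
            minim f ⟨ xs ⟩↓ y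

  data _⟨_⟩↓*_ {n} : ∀ {m} → Vec (Rec n) m → Vec ℕ n → Vec ℕ m → Set where
    []  : ∀ {xs} → [] ⟨ xs ⟩↓* []
    _∷_ : ∀ {m g} {gs : Vec (Rec n) m} {xs y ys} →
          g ⟨ xs ⟩↓ y → gs ⟨ xs ⟩↓* ys → (g ∷ gs) ⟨ xs ⟩↓* (y ∷ ys)

-- Partial functions are given by their graphs.

PartialComputable₁ : (ℕ → ℕ → Set) → Set
PartialComputable₁ ψ = Σ (Rec 1) λ f → ∀ x y → ψ x y ⇔ f ⟨ x ∷ [] ⟩↓ y

PartialComputable₂ : (ℕ → ℕ → ℕ → Set) → Set
PartialComputable₂ ψ = Σ (Rec 2) λ f → ∀ w x y → ψ w x y ⇔ f ⟨ w ∷ x ∷ [] ⟩↓ y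

Computable : (ℕ → ℕ) → Set
Computable h = PartialComputable₁ (λ x y → h x ≡ y)

-- φ e x y reads "φₑ(x) halts with value y".  Acceptability is Rogers'
-- criterion: a universal function (enumeration theorem) together with
-- parametrisation (s-m-n).

record AcceptableNumbering : Set₁ where
  field
    φ         : ℕ → ℕ → ℕ → Set
    complete  : ∀ (ψ : ℕ → ℕ → Set) → PartialComputable₁ ψ →
                ∃[ e ] (∀ x y → φ e x y ⇔ ψ x y)
    universal : PartialComputable₂ φ
    smn       : ∀ (ψ : ℕ → ℕ → ℕ → Set) → PartialComputable₂ ψ →
                ∃[ s ] Computable s × (∀ w x y → φ (s w) x y ⇔ ψ w x y)

  W : ℕ → Pred ℕ 0ℓ
  W e x = ∃[ y ] φ e x y

  _=ᶜᵉ_ : Rel ℕ 0ℓ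
  e =ᶜᵉ e′ = W e ≐ W e′

  IsCE : Pred ℕ 0ℓ → Set
  IsCE A = ∃[ e ] A ≐ W e

------------------------------------------------------------------------
-- Learning

-- An enumeration of A, i.e. a surjection ω → A, is a function with range A.

record Enumerates (μ : ℕ → ℕ) (A : Pred ℕ 0ℓ) : Set where
  field
    sound : ∀ n → μ n ∈ A
    onto  : ∀ {x} → x ∈ A → ∃[ n ] μ n ≡ x

infix 30 _[_]

_[_] : (ℕ → ℕ) → ℕ → List ℕ
μ [ s ] = applyUpTo μ s

Learner : Set
Learner = List ℕ → ℕ

module _ (𝒩 : AcceptableNumbering) where
  open AcceptableNumbering 𝒩

  record ℛᶜᵉ : Set₁ where
    field
      _~_           : Rel ℕ 0ℓ
      isEquivalence : IsEquivalence _~_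
      extends-=ᶜᵉ   : _=ᶜᵉ_ ⇒ _~_

  -- Sets are predicates compared by _≐_, so a family of sets must be closed
  -- under extensional equality.

  record Family : Set₁ where
    field
      Member    : Pred (Pred ℕ 0ℓ) 0ℓ
      respects  : Member Respects _≐_
      ce        : ∀ {A} → A ∈ Member → IsCE A
      nonempty  : ∀ {A} → A ∈ Member → Satisfiable A

module _ {𝒩 : AcceptableNumbering} where
  open AcceptableNumbering 𝒩

  Learnable : ℛᶜᵉ 𝒩 → Family 𝒩 → Set
  Learnable E 𝔎 =
    Σ Learner λ M →
      ∀ e → W e ∈ Member →
      ∀ μ → Enumerates μ (W e) →
      ∃[ i ] i ~ e × (∃[ s₀ ] ∀ s → s ≥ s₀ → M (μ [ s ]) ≡ i)
    where
    open ℛᶜᵉ E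
    open Family 𝔎

  infix 4 _≤Learn_ _≡Learn_

  _≤Learn_ : Rel (ℛᶜᵉ 𝒩) (lsuc 0ℓ)
  E ≤Learn F = ∀ 𝔎 → Learnable E 𝔎 → Learnable F 𝔎

  _≡Learn_ : Rel (ℛᶜᵉ 𝒩) (lsuc 0ℓ)
  E ≡Learn F = E ≤Learn F × F ≤Learn E

  infixl 6 _∩ᶜᵉ_

  _∩ᶜᵉ_ : ℛᶜᵉ 𝒩 → ℛᶜᵉ 𝒩 → ℛᶜᵉ 𝒩
  E ∩ᶜᵉ F = record
    { _~_           = E._~_ Intersection.∩ F._~_
    ; isEquivalence = Intersection.isEquivalence E.isEquivalence F.isEquivalence
    ; extends-=ᶜᵉ   = λ p → E.extends-=ᶜᵉ p , F.extends-=ᶜᵉ p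
    }
    where
    module E = ℛᶜᵉ E
    module F = ℛᶜᵉ F

-- The quotient by ≡Learn is rendered by taking ≡Learn as the equality of the
-- poset: an element E of the carrier stands for its class.

TLH : AcceptableNumbering → Poset (lsuc 0ℓ) (lsuc 0ℓ) (lsuc 0ℓ)
TLH 𝒩 = record
  { Carrier        = ℛᶜᵉ 𝒩
  ; _≈_            = _≡Learn_
  ; _≤_            = _≤Learn_
  ; isPartialOrder = record
    { isPreorder = record
      { isEquivalence = record
        { refl  = (λ _ → id) , (λ _ → id)
        ; sym   = swap
        ; trans = λ p q → (λ 𝔎 → proj₁ q 𝔎 ∘ proj₁ p 𝔎)
                        , (λ 𝔎 → proj₂ p 𝔎 ∘ proj₂ q 𝔎)
        }
      ; reflexive = proj₁
      ; trans     = λ p q 𝔎 → q 𝔎 ∘ p 𝔎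
      }
    ; antisym = _,_
    }
  }

------------------------------------------------------------------------
-- Lower semilattices

module _ {c ℓ₁ ℓ₂ : Level} (P : Poset c ℓ₁ ℓ₂) where
  open Poset P

  IsMeet : Carrier → Carrier → Carrier → Set (c ⊔ ℓ₂)
  IsMeet x y m = m ≤ x × m ≤ y × (∀ z → z ≤ x → z ≤ y → z ≤ m)

  IsLowerSemilattice : Set (c ⊔ ℓ₂)
  IsLowerSemilattice = ∀ x y → ∃[ m ] IsMeet x y m

{-# OPTIONS --safe #-}
-- Suppose M learns 𝔎 up to E and N learns 𝔎 up to F.  On data for W e their
-- conjectures settle on some i ~ e (E) and j ~ e (F).  Any k with k ~ i (E) and
-- k ~ j (F) is then equivalent to e under E ∩ F, and such a k exists since e is
-- one.  As learners need not be effective, a fixed choice of k for each pair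
-- (i , j) turns M and N into a learner up to E ∩ F.

module Submission where

open import Defs
open import Axiom.ExcludedMiddle using (ExcludedMiddle)
open import Data.Nat.Base using (ℕ; _⊔_)
open import Data.Nat.Properties using (m⊔n≤o⇒m≤o; m⊔n≤o⇒n≤o)
open import Data.Product.Base using (∃-syntax; _×_; _,_; proj₁; proj₂)
open import Level using (0ℓ)
open import Relation.Binary.PropositionalEquality.Core using (cong₂)
open import Relation.Binary.Structures using (IsEquivalence)
open import Relation.Nullary.Decidable.Core using (Dec; yes; no)
open import Relation.Nullary.Negation.Core using (contradiction)
open import Relation.Unary using (Pred; Satisfiable)

-- The default 0 keeps the merged learner total; along an enumeration of a learned set it is needed
-- only finitely often, before both conjectures settle.
witnessOr0 : {P : Pred ℕ 0ℓ} → Dec (Satisfiable P) → ℕ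
witnessOr0 (yes (k , _)) = k
witnessOr0 (no _)        = 0

witnessOr0-satisfies : {P : Pred ℕ 0ℓ} (d : Dec (Satisfiable P)) →
                       Satisfiable P → P (witnessOr0 d)
witnessOr0-satisfies (yes (_ , p)) _ = p
witnessOr0-satisfies (no ¬p)       p = contradiction p ¬p

module _ (𝒩 : AcceptableNumbering) where

  -- The same learner works: its limit conjecture stays correct for the coarser relation.
  Learnable-mono : (E F : ℛᶜᵉ 𝒩) → (∀ {i j} → ℛᶜᵉ._~_ E i j → ℛᶜᵉ._~_ F i j) →
                   E ≤Learn F
  Learnable-mono E F E⇒F 𝔎 (M , learns) = M , λ e e∈𝔎 μ enum →
    let i , i~e , conv = learns e e∈𝔎 μ enum in i , E⇒F i~e , conv

  Learnable-∩ : ExcludedMiddle 0ℓ → (E F : ℛᶜᵉ 𝒩) (𝔎 : Family 𝒩) →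
                Learnable E 𝔎 → Learnable F 𝔎 → Learnable (E ∩ᶜᵉ F) 𝔎
  Learnable-∩ em E F 𝔎 (M , M-learns) (N , N-learns) = (λ σ → merge (M σ) (N σ)) ,
    λ e e∈𝔎 μ enum →
      let i , i~e , s , M-conv = M-learns e e∈𝔎 μ enum
          j , j~e , t , N-conv = N-learns e e∈𝔎 μ enum
          -- `merge i j` unfolds to a choice by this same decision, so the properties hold of the
          -- merged conjecture itself.
          k~i , k~j = witnessOr0-satisfies (em {Common i j})
                        (e , E.sym i~e , F.sym j~e)
      in merge i j , (E.trans k~i i~e , F.trans k~j j~e) , s ⊔ t ,
         λ r r≥ → cong₂ merge (M-conv r (m⊔n≤o⇒m≤o s t r≥))
                              (N-conv r (m⊔n≤o⇒n≤o s t r≥))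
    where
    module E where
      open ℛᶜᵉ E public
      open IsEquivalence isEquivalence public
    module F where
      open ℛᶜᵉ F public
      open IsEquivalence isEquivalence public

    Common : ℕ → ℕ → Set
    Common i j = ∃[ k ] (k E.~ i) × (k F.~ j)

    merge : ℕ → ℕ → ℕ
    merge i j = witnessOr0 (em {Common i j})

  ∩ᶜᵉ-isMeet : ExcludedMiddle 0ℓ → (E F : ℛᶜᵉ 𝒩) → IsMeet (TLH 𝒩) E F (E ∩ᶜᵉ F)
  ∩ᶜᵉ-isMeet em E F =
    Learnable-mono (E ∩ᶜᵉ F) E proj₁ ,
    Learnable-mono (E ∩ᶜᵉ F) F proj₂ ,
    -- A learner up to `Z` yields one up to `E` and one up to `F`, which are then merged.
    λ Z Z≤E Z≤F 𝔎 l → Learnable-∩ em E F 𝔎 (Z≤E 𝔎 l) (Z≤F 𝔎 l)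

corollary4p6 : ExcludedMiddle 0ℓ → (𝒩 : AcceptableNumbering) →
    IsLowerSemilattice (TLH 𝒩) ×
    (∀ (E F : ℛᶜᵉ 𝒩) → IsMeet (TLH 𝒩) E F (E ∩ᶜᵉ F))
corollary4p6 em 𝒩 = (λ E F → E ∩ᶜᵉ F , ∩ᶜᵉ-isMeet 𝒩 em E F) , ∩ᶜᵉ-isMeet 𝒩 em
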